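{- Let $y\in X$, $\beta\in\overline{\mathcal{T}}(y)$, and let $f=f_{y=\beta}:\overline{\mathcal{G}(\mathcal{T})}\to\overline{\mathcal{G}(\mathcal{T})}$ be the (extended) transfer function. For any $\emptyset\neq S\subseteq\overline{\mathcal{G}(\mathcal{T})}$, $f(\bigwedge S)=\bigwedge f(S)$, where $f(S)=\{f(s):s\in S\}$.
   Context: $C$ is a countable set of constants, $X$ a countable set of variables, and $\mathcal{T}$ is the set of formal expressions (terms) given by $t::=c\mid x\mid (t+t)$ with $c\in C$, $x\in X$. $t[x\leftarrow\alpha]$ denotes the term obtained from $t$ by replacing every occurrence of the variable $x$ by the term $\alpha$. $\overline{\mathcal{T}}(y)$ is the set of terms in which $y$ does not appear. For a partition $\mathcal{P}$ of $\mathcal{T}$ write $t\cong_{\mathcal{P}}t'$ if $t,t'$ lie in the same class. $\mathcal{P}$ is a congruence if: (1) distinct constants $c\neq c'$ satisfy $c\ncong_{\mathcal P} c'$; (2) for all $t,t',s,s'\in\mathcal{T}$, ($t'\cong_{\mathcal P} t$ and $s'\cong_{\mathcal P} s$) if and only if $t'+s'\cong_{\mathcal P} t+s$; (3) for $c\in C$, $t\in\mathcal{T}$, if $t\cong_{\mathcal P} c$ then $t=c$ or $t\in X$. $\mathcal{G}(\mathcal{T})$ is the set of all congruences, ordered by refinement: $\mathcal{P}\preceq\mathcal{P}'$ if each class of $\mathcal{P}$ is contained in a class of $\mathcal{P}'$. $\overline{\mathcal{G}(\mathcal{T})}=\mathcal{G}(\mathcal{T})\cup\{\top\}$ where $\top$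 is an added element with $\mathcal{P}\preceq\top$ for all $\mathcal{P}$; it is a complete lattice, and $\bigwedge$ denotes greatest lower bound in it. For $\mathcal{P}=\{A_i\}_{i\in I}\in\mathcal{G}(\mathcal{T})$, set $B_i=\{t\in\mathcal{T}:t[y\leftarrow\beta]\in A_i\}$ and $f_{y=\beta}(\mathcal{P})=\{B_i:i\in I,B_i\neq\emptyset\}$ (this is a congruence). The extended transfer function additionally sends $\top$ to $\top$. -}

module Defs where

open import Axiom.ExcludedMiddle using (ExcludedMiddle)
open import Data.Empty using (⊥-elim)
import Data.Maybe.Base as Maybe
open import Data.Nat.Base using (ℕ)
open import Data.Nat.Properties using (eq?)
open import Data.Product using (Σ; ∃; _×_; _,_; proj₁; proj₂)
open import Data.Sum using (_⊎_; inj₁; inj₂)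
open import Function.Base using (_∘_)
open import Function.Bundles using (_↣_; _⇔_; mk⇔; Equivalence)
open import Level using (Level; 0ℓ; _⊔_) renaming (suc to lsuc)
open import Relation.Binary.Core using (Rel)
open import Relation.Binary.Definitions using (DecidableEquality)
import Relation.Binary.Construct.Add.Supremum.NonStrict as AddSupremum
open import Relation.Binary.PropositionalEquality using (_≡_; _≢_; refl)
open import Relation.Nullary using (¬_; yes; no)
open import Relation.Nullary.Decidable using (True; toWitness; fromWitness)
open import Relation.Nullary.Construct.Add.Supremum public using (_⁺; ⊤⁺; [_])
open import Relation.Unary using (Pred; _∈_; _⊆_; _≐_; Satisfiable)

private variable
  a b ℓ ℓ₁ ℓ₂ : Level

image : {A : Set a} {B : Set b} → (A → B) → Pred A ℓ → Pred B (a ⊔ b ⊔ ℓ)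
image f S u = ∃ λ s → s ∈ S × u ≡ f s

record IsGLB {A : Set a} (_≤_ : Rel A ℓ₁) (S : Pred A ℓ₂) (m : A)
             : Set (a ⊔ ℓ₁ ⊔ ℓ₂) where
  field
    lower    : ∀ s → s ∈ S → m ≤ s
    greatest : ∀ n → (∀ s → s ∈ S → n ≤ s) → n ≤ m

-- A partition is a family of nonempty, covering classes.  The family may list
-- the same class under several indices, so disjointness of distinct classes
-- reads: two classes with a common element have the same elements.
record Partition (T : Set) : Set₁ where
  field
    Index    : Set
    class    : Index → Pred T 0ℓ
    nonempty : ∀ i → Satisfiable (class i)
    cover    : ∀ t → ∃ λ i → t ∈ class i
    disjoint : ∀ {i j t} → t ∈ class i → t ∈ class j → class i ≐ class j

  infix 4 _≅_
  _≅_ : Rel T 0ℓ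
  t ≅ t′ = ∃ λ i → t ∈ class i × t′ ∈ class i

-- Countable sets are given by an injection into ℕ, so they may be finite.
module Expressions (C X : Set) (countC : C ↣ ℕ) (countX : X ↣ ℕ) where

  infixl 6 _+_
  data Term : Set where
    const : C → Term
    var   : X → Term
    _+_   : Term → Term → Term

  data _occursIn_ (y : X) : Term → Set where
    here  : y occursIn var y
    left  : ∀ {t s} → y occursIn t → y occursIn (t + s)
    right : ∀ {t s} → y occursIn s → y occursIn (t + s)

  TermWithout : X → Pred Term 0ℓ
  TermWithout y t = ¬ (y occursIn t)

  _≟ˣ_ : DecidableEquality X
  _≟ˣ_ = eq? countX

  infix 8 _[_←_]
  _[_←_] : Term → X → Term → Term
  const c [ x ← α ] = const c
  var z   [ x ← α ] with z ≟ˣ x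
  ... | yes _ = α
  ... | no  _ = var z
  (t + s) [ x ← α ] = t [ x ← α ] + s [ x ← α ]

  record IsCongruence (P : Partition Term) : Set where
    open Partition P
    field
      const-≇ : ∀ {c c′} → c ≢ c′ → ¬ (const c ≅ const c′)
      +-≅     : ∀ t t′ s s′ → (t′ ≅ t × s′ ≅ s) ⇔ (t′ + s′ ≅ t + s)
      ≅-const : ∀ c t → t ≅ const c → t ≡ const c ⊎ ∃ λ x → t ≡ var x

  record Congruence : Set₁ where
    field
      partition    : Partition Term
      isCongruence : IsCongruence partition
    open Partition partition public
    open IsCongruence isCongruence public

  infix 4 _≼_
  _≼_ : Rel Congruence 0ℓ
  P ≼ Q = ∀ i → ∃ λ j → P.class i ⊆ Q.class j
    where
      module P = Congruence P
      module Q = Congruence Q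

  open AddSupremum _≼_ public renaming (_≤⁺_ to _≼⁺_) using ([_]; _≤⊤⁺)

  transferPartition : X → Term → Partition Term → Partition Term
  transferPartition y β P = record
    { Index    = Σ P.Index λ i → Satisfiable (B i)
    ; class    = λ (i , _) → B i
    ; nonempty = proj₂
    ; cover    = λ t → let i , t∈ = P.cover (t [ y ← β ]) in (i , t , t∈) , t∈
    ; disjoint = λ t∈i t∈j → let i⊆j , j⊆i = P.disjoint t∈i t∈j
                             in (λ t∈ → i⊆j t∈) , (λ t∈ → j⊆i t∈)
    }
    where
      module P = Partition P

      B : P.Index → Pred Term 0ℓ
      B i t = t [ y ← β ] ∈ P.class i

  transfer : X → Term → Congruence → Congruence
  transfer y β P = record
    { partition    = transferPartition y β P.partition
    ; isCongruence = record
      { const-≇ = λ {c} {c′} c≢c′ → P.const-≇ c≢c′ ∘ to (const c) (const c′)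
      ; +-≅     = λ t t′ s s′ → mk⇔
          (λ (p , q) → from (t′ + s′) (t + s)
            (Equivalence.to (P.+-≅ _ _ _ _) (to t′ t p , to s′ s q)))
          (λ r → let p , q = Equivalence.from (P.+-≅ _ _ _ _) (to (t′ + s′) (t + s) r)
                 in from t′ t p , from s′ s q)
      ; ≅-const = λ c t → ≅-const c t ∘ to t (const c)
      }
    }
    where
      module P = Congruence P
      open Partition (transferPartition y β P.partition) using (_≅_)

      to : ∀ t t′ → t ≅ t′ → t [ y ← β ] P.≅ t′ [ y ← β ]
      to _ _ ((i , _) , p , q) = i , p , q

      from : ∀ t t′ → t [ y ← β ] P.≅ t′ [ y ← β ] → t ≅ t′
      from t _ (i , p , q) = (i , t , p) , p , q

      ≅-const : ∀ c t → t [ y ← β ] P.≅ const c → t ≡ const c ⊎ ∃ λ x → t ≡ var x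
      ≅-const c (const d) p = P.≅-const c (const d) p
      ≅-const c (var x)   p = inj₂ (x , refl)
      ≅-const c (t + s)   p with P.≅-const c _ p
      ... | inj₁ ()
      ... | inj₂ (_ , ())

  transfer⁺ : X → Term → Congruence ⁺ → Congruence ⁺
  transfer⁺ y β = Maybe.map (transfer y β)

  -- Greatest lower bounds are unique: mutual refinement means having the same
  -- classes.
  ≼-antisym : ∀ {P Q} → P ≼ Q → Q ≼ P →
              ∀ i → ∃ λ j → Congruence.class P i ≐ Congruence.class Q j
  ≼-antisym {P} P≼Q Q≼P i =
    let j , i⊆j = P≼Q i
        k , j⊆k = Q≼P j
        t , t∈i = P.nonempty i
    in j , i⊆j , λ u∈j → proj₂ (P.disjoint t∈i (j⊆k (i⊆j t∈i))) (j⊆k u∈j)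
    where module P = Congruence P

  -- Greatest lower bounds exist classically: ⊤⁺ for a family without
  -- congruences, otherwise the intersection of the congruences in it.
  module _ (em : ExcludedMiddle (lsuc 0ℓ ⊔ ℓ)) (S : Pred (Congruence ⁺) ℓ) where

    glb-exists : ∃ λ m → IsGLB _≼⁺_ S m
    glb-exists with em {∃ λ P → [ P ] ∈ S}
    ... | no none = ⊤⁺ , record
      { lower    = λ { ⊤⁺ _ → ⊤⁺ ≤⊤⁺ ; [ P ] P∈S → ⊥-elim (none (P , P∈S)) }
      ; greatest = λ n _ → n ≤⊤⁺
      }
    ... | yes (P₀ , P₀∈S) = [ ⋂ ] , record
      { lower    = λ { ⊤⁺ _ → _ ≤⊤⁺ ; [ P ] P∈S → [ below P P∈S ] }
      ; greatest = λ { ⊤⁺ h → ⊥-elim (⊤⋠ (h _ P₀∈S)) ; [ N ] h → [ above N h ] }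
      }
      where
        open Congruence using () renaming (_≅_ to _⊢_≅_)

        ⊤⋠ : ∀ {P} → ¬ (⊤⁺ ≼⁺ [ P ])
        ⊤⋠ ()

        ≅-refl : ∀ P {t} → P ⊢ t ≅ t
        ≅-refl P {t} = let i , t∈i = Congruence.cover P t in i , t∈i , t∈i

        ≅-sym : ∀ P {t u} → P ⊢ t ≅ u → P ⊢ u ≅ t
        ≅-sym P (i , p , q) = i , q , p

        ≅-trans : ∀ P {t u v} → P ⊢ t ≅ u → P ⊢ u ≅ v → P ⊢ t ≅ v
        ≅-trans P (i , p , q) (j , r , s) =
          i , p , proj₂ (Congruence.disjoint P q r) s

        All : Rel Term _
        All t u = ∀ P → [ P ] ∈ S → P ⊢ t ≅ u

        _~_ : Rel Term 0ℓ
        t ~ u = True (em {All t u})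

        ~-trans : ∀ {t u v} → t ~ u → u ~ v → t ~ v
        ~-trans p q = fromWitness λ P P∈S →
          ≅-trans P (toWitness p P P∈S) (toWitness q P P∈S)

        ~-sym : ∀ {t u} → t ~ u → u ~ t
        ~-sym p = fromWitness λ P P∈S → ≅-sym P (toWitness p P P∈S)

        ~-refl : ∀ {t} → t ~ t
        ~-refl = fromWitness λ P _ → ≅-refl P

        ⋂-partition : Partition Term
        ⋂-partition = record
          { Index    = Term
          ; class    = _~_
          ; nonempty = λ t → t , ~-refl
          ; cover    = λ t → t , ~-refl
          ; disjoint = λ p q → (λ r → ~-trans q (~-trans (~-sym p) r))
                             , (λ r → ~-trans p (~-trans (~-sym q) r))
          }

        open Partition ⋂-partition using (_≅_)

        to : ∀ {t u} → t ≅ u → All t u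
        to (_ , p , q) = toWitness (~-trans (~-sym p) q)

        from : ∀ {t u} → All t u → t ≅ u
        from h = _ , ~-refl , fromWitness h

        ⋂ : Congruence
        ⋂ = record
          { partition    = ⋂-partition
          ; isCongruence = record
            { const-≇ = λ c≢c′ p → Congruence.const-≇ P₀ c≢c′ (to p P₀ P₀∈S)
            ; +-≅     = λ t t′ s s′ → mk⇔
                (λ (p , q) → from λ P P∈S →
                  Equivalence.to (Congruence.+-≅ P _ _ _ _) (to p P P∈S , to q P P∈S))
                (λ r →
                  let h = λ P P∈S → Equivalence.from (Congruence.+-≅ P _ _ _ _) (to r P P∈S)
                  in from (λ P P∈S → proj₁ (h P P∈S)) , from (λ P P∈S → proj₂ (h P P∈S)))
            ; ≅-const = λ c t p → Congruence.≅-const P₀ c t (to p P₀ P₀∈S)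
            }
          }

        below : ∀ P → [ P ] ∈ S → ⋂ ≼ P
        below P P∈S t =
          let i , t∈i = Congruence.cover P t
          in i , λ t~u → let j , t∈j , u∈j = toWitness t~u P P∈S
                         in proj₂ (Congruence.disjoint P t∈i t∈j) u∈j

        above : ∀ N → (∀ s → s ∈ S → [ N ] ≼⁺ s) → N ≼ ⋂
        above N h i =
          let t , t∈i = Congruence.nonempty N i
          in t , λ u∈i → fromWitness λ P P∈S → refine P (h _ P∈S) t∈i u∈i
          where
            refine : ∀ P → [ N ] ≼⁺ [ P ] → ∀ {t u} →
                     t ∈ Congruence.class N i → u ∈ Congruence.class N i → P ⊢ t ≅ u
            refine P [ N≼P ] t∈i u∈i = let j , i⊆j = N≼P i in j , i⊆j t∈i , i⊆j u∈i

{-# OPTIONS --safe #-}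

-- Since t and u are congruent in f(P) exactly when t[y←β] and u[y←β] are
-- congruent in P, the map f behaves like a right adjoint: N ≼ f(P) holds iff P
-- contains the relation generated, under the closure rules of a congruence, by
-- the pairs (t[y←β] , u[y←β]) with t, u congruent in N.  This generated relation
-- is itself a congruence as soon as it lies below one.
module Submission where

open import Defs
open import Data.Nat.Base using (ℕ)
open import Data.Nat.Properties using (eq?)
open import Data.Empty using (⊥-elim)
open import Data.Product using (∃; _,_; proj₁; proj₂)
open import Data.Sum using (_⊎_; inj₁; inj₂)
open import Function.Bundles using (_↣_; mk⇔; Equivalence)
open import Level using (Level; 0ℓ)
open import Relation.Binary.Core using (Rel; _⇒_)
open import Relation.Binary.PropositionalEquality using (_≡_; refl; cong)
open import Relation.Nullary using (¬_; yes; no)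
open import Relation.Unary using (Pred; _∈_; Satisfiable)

module PartitionProperties {T : Set} (P : Partition T) where
  open Partition P

  ≅-refl : ∀ {t} → t ≅ t
  ≅-refl {t} = let i , t∈i = cover t in i , t∈i , t∈i

  ≅-sym : ∀ {t u} → t ≅ u → u ≅ t
  ≅-sym (i , t∈i , u∈i) = i , u∈i , t∈i

  ≅-trans : ∀ {t u v} → t ≅ u → u ≅ v → t ≅ v
  ≅-trans (i , t∈i , u∈i) (j , u∈j , v∈j) =
    i , t∈i , proj₂ (disjoint u∈i u∈j) v∈j

module TransferProperties (C X : Set) (countC : C ↣ ℕ) (countX : X ↣ ℕ) where
  open Expressions C X countC countX
  open Congruence using () renaming (_≅_ to _⊢_≅_)

  ≼⇒≅ : ∀ {P Q} → P ≼ Q → (P ⊢_≅_) ⇒ (Q ⊢_≅_)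
  ≼⇒≅ P≼Q (i , t∈i , u∈i) = let j , i⊆j = P≼Q i in j , i⊆j t∈i , i⊆j u∈i

  -- A single `Q`-class must be chosen for the whole class `i`: take the one covering some
  -- representative `t`. Disjointness identifies it with the class that `P⇒Q` yields for each other
  -- member.
  ≅⇒≼ : ∀ {P Q} → (P ⊢_≅_) ⇒ (Q ⊢_≅_) → P ≼ Q
  ≅⇒≼ {P} {Q} P⇒Q i =
    let t , t∈i = Congruence.nonempty P i
        j , t∈j = Congruence.cover Q t
    in j , λ u∈i → let k , t∈k , u∈k = P⇒Q (i , t∈i , u∈i)
                   in proj₂ (Congruence.disjoint Q t∈j t∈k) u∈k

  -- `projˡ` and `projʳ` encode the backward half of condition (2). The conditions on constants only
  -- forbid pairs, so they cannot be generated and must be inherited from a congruence containing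
  -- `R`.
  data Generated (R : Rel Term 0ℓ) : Rel Term 0ℓ where
    gen   : R ⇒ Generated R
    rfl   : ∀ {t} → Generated R t t
    symm  : ∀ {t u} → Generated R t u → Generated R u t
    trns  : ∀ {t u v} → Generated R t u → Generated R u v → Generated R t v
    plus  : ∀ {t t′ s s′} → Generated R t′ t → Generated R s′ s →
            Generated R (t′ + s′) (t + s)
    projˡ : ∀ {t t′ s s′} → Generated R (t′ + s′) (t + s) → Generated R t′ t
    projʳ : ∀ {t t′ s s′} → Generated R (t′ + s′) (t + s) → Generated R s′ s

  Generated-least : ∀ {R} P → R ⇒ (P ⊢_≅_) → Generated R ⇒ (P ⊢_≅_)
  Generated-least P R⇒P = go
    where
    open Congruence P using (+-≅)
    open PartitionProperties (Congruence.partition P)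

    go : Generated _ ⇒ (P ⊢_≅_)
    go (gen r)    = R⇒P r
    go rfl        = ≅-refl
    go (symm p)   = ≅-sym (go p)
    go (trns p q) = ≅-trans (go p) (go q)
    go (plus p q) = Equivalence.to (+-≅ _ _ _ _) (go p , go q)
    go (projˡ p)  = proj₁ (Equivalence.from (+-≅ _ _ _ _) (go p))
    go (projʳ p)  = proj₂ (Equivalence.from (+-≅ _ _ _ _) (go p))

  -- A doubly negated bound is enough, because the conditions on constants are
  -- stable under double negation (C has decidable equality).
  module _ (R : Rel Term 0ℓ) (bounded : ¬ ¬ ∃ λ P → R ⇒ (P ⊢_≅_)) where

    generatedPartition : Partition Term
    generatedPartition = record
      { Index    = Term
      ; class    = Generated R
      ; nonempty = λ t → t , rfl
      ; cover    = λ t → t , rfl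
      ; disjoint = λ p q → (λ r → trns q (trns (symm p) r))
                         , (λ r → trns p (trns (symm q) r))
      }

    open Partition generatedPartition using (_≅_)

    ≅⇒Generated : _≅_ ⇒ Generated R
    ≅⇒Generated (_ , p , q) = trns (symm p) q

    Generated⇒≅ : Generated R ⇒ _≅_
    Generated⇒≅ p = _ , rfl , p

    generated-≅-const : ∀ c t → t ≅ const c → t ≡ const c ⊎ ∃ λ x → t ≡ var x
    -- Deciding `d ≡ c` leaves only a contradiction to derive, which the doubly negated bound can
    -- supply.
    generated-≅-const c (const d) p with eq? countC d c
    ... | yes d≡c = inj₁ (cong const d≡c)
    ... | no  d≢c = ⊥-elim (bounded λ (P , R⇒P) →
      Congruence.const-≇ P d≢c (Generated-least P R⇒P (≅⇒Generated p)))
    generated-≅-const c (var x) p = inj₂ (x , refl)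
    generated-≅-const c (t + s) p = ⊥-elim (bounded λ (P , R⇒P) →
      +≢ (Congruence.≅-const P c (t + s) (Generated-least P R⇒P (≅⇒Generated p))))
      where
      +≢ : ¬ (t + s ≡ const c ⊎ ∃ λ x → t + s ≡ var x)
      +≢ (inj₁ ())
      +≢ (inj₂ (_ , ()))

    generatedCongruence : Congruence
    generatedCongruence = record
      { partition    = generatedPartition
      ; isCongruence = record
        { const-≇ = λ c≢c′ p → bounded λ (P , R⇒P) →
            Congruence.const-≇ P c≢c′ (Generated-least P R⇒P (≅⇒Generated p))
        ; +-≅     = λ _ _ _ _ → mk⇔
            (λ (p , q) → Generated⇒≅ (plus (≅⇒Generated p) (≅⇒Generated q)))
            (λ p → Generated⇒≅ (projˡ (≅⇒Generated p))
                 , Generated⇒≅ (projʳ (≅⇒Generated p)))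
        ; ≅-const = generated-≅-const
        }
      }

    generatedCongruence-least : ∀ P → R ⇒ (P ⊢_≅_) → generatedCongruence ≼ P
    generatedCongruence-least P R⇒P =
      ≅⇒≼ {generatedCongruence} {P} λ p → Generated-least P R⇒P (≅⇒Generated p)

  module _ (y : X) (β : Term) where

    transfer-≅⁺ : ∀ P t u → P ⊢ t [ y ← β ] ≅ u [ y ← β ] → transfer y β P ⊢ t ≅ u
    -- The index carries `t` as witness that the preimage of class `i` is nonempty.
    transfer-≅⁺ P t _ (i , p , q) = (i , t , p) , p , q

    transfer-≅⁻ : ∀ P t u → transfer y β P ⊢ t ≅ u → P ⊢ t [ y ← β ] ≅ u [ y ← β ]
    transfer-≅⁻ P _ _ ((i , _) , p , q) = i , p , q

    transfer-mono : ∀ {P Q} → P ≼ Q → transfer y β P ≼ transfer y β Q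
    transfer-mono {P} {Q} P≼Q = ≅⇒≼ {transfer y β P} {transfer y β Q} λ {t} {u} p →
      transfer-≅⁺ Q t u (≼⇒≅ {P} {Q} P≼Q (transfer-≅⁻ P t u p))

    transfer⁺-mono : ∀ {p q} → p ≼⁺ q → transfer⁺ y β p ≼⁺ transfer⁺ y β q
    transfer⁺-mono (p ≤⊤⁺) = _ ≤⊤⁺
    transfer⁺-mono ([_] {P} {Q} P≼Q) = [ transfer-mono {P} {Q} P≼Q ]

    data Substituted (N : Congruence) : Rel Term 0ℓ where
      substituted : ∀ {t u} → N ⊢ t ≅ u → Substituted N (t [ y ← β ]) (u [ y ← β ])

    -- With its converse `Substituted⇒≅⇒≼transfer`, this moves the substitution from `P` over to
    -- `N`, so that `P` can be compared inside `S` itself.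
    ≼transfer⇒Substituted⇒≅ : ∀ {N} P → N ≼ transfer y β P → Substituted N ⇒ (P ⊢_≅_)
    ≼transfer⇒Substituted⇒≅ {N} P N≼fP (substituted {t} {u} p) =
      transfer-≅⁻ P t u (≼⇒≅ {N} {transfer y β P} N≼fP p)

    Substituted⇒≅⇒≼transfer : ∀ {N} P → Substituted N ⇒ (P ⊢_≅_) → N ≼ transfer y β P
    Substituted⇒≅⇒≼transfer {N} P S⇒P =
      ≅⇒≼ {N} {transfer y β P} λ {t} {u} p → transfer-≅⁺ P t u (S⇒P (substituted p))

    module _ {ℓ : Level} {S : Pred (Congruence ⁺) ℓ} where

      -- A lower bound of the image is pulled back to a lower bound of `S`: `⊤⁺` to itself, `[ N ]`
      -- to the congruence generated by `Substituted N`. The latter lies below `m`, and the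
      -- adjunction carries this back to `N`.
      transfer⁺-greatest : ∀ {m} → IsGLB _≼⁺_ S m →
        ∀ n → (∀ s → s ∈ S → n ≼⁺ transfer⁺ y β s) → n ≼⁺ transfer⁺ y β m
      transfer⁺-greatest {⊤⁺} glb n n≤fS = n ≤⊤⁺
      transfer⁺-greatest {[ M ]} glb ⊤⁺ n≤fS =
        -- Only `⊤⁺` is sent to `⊤⁺`, so here `⊤⁺` would be a lower bound of `S` and hence lie below
        -- `[ M ]`.
        ⊥-elim (⊤⋠ (IsGLB.greatest glb ⊤⁺ λ s s∈S → reflect⊤ s (n≤fS s s∈S)))
        where
        ⊤⋠ : ∀ {P} → ¬ (⊤⁺ ≼⁺ [ P ])
        ⊤⋠ ()

        reflect⊤ : ∀ s → ⊤⁺ ≼⁺ transfer⁺ y β s → ⊤⁺ ≼⁺ s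
        reflect⊤ ⊤⁺ _ = ⊤⁺ ≤⊤⁺
      transfer⁺-greatest {[ M ]} glb [ N ] n≤fS =
        [ Substituted⇒≅⇒≼transfer {N} M (λ r → G⇒M (gen r)) ]
        where
        R⇒ : ∀ P → [ P ] ∈ S → Substituted N ⇒ (P ⊢_≅_)
        R⇒ P P∈S with n≤fS [ P ] P∈S
        ... | [ N≼fP ] = ≼transfer⇒Substituted⇒≅ {N} P N≼fP

        -- If S contained no congruence, its greatest lower bound would be ⊤⁺.
        bounded : ¬ ¬ ∃ λ P → Substituted N ⇒ (P ⊢_≅_)
        bounded none with IsGLB.greatest glb ⊤⁺
          (λ { ⊤⁺ _ → ⊤⁺ ≤⊤⁺ ; [ P ] P∈S → ⊥-elim (none (P , R⇒ P P∈S)) })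
        ... | ()

        G : Congruence
        G = generatedCongruence (Substituted N) bounded

        G≼M : G ≼ M
        G≼M with IsGLB.greatest glb [ G ]
          (λ { ⊤⁺ _ → _ ≤⊤⁺
             ; [ P ] P∈S →
                 [ generatedCongruence-least (Substituted N) bounded P (R⇒ P P∈S) ] })
        ... | [ p ] = p

        G⇒M : Generated (Substituted N) ⇒ (M ⊢_≅_)
        G⇒M p = ≼⇒≅ {G} {M} G≼M (Generated⇒≅ (Substituted N) bounded p)

theorem6p4 : ∀ {ℓ : Level} (C X : Set) (countC : C ↣ ℕ) (countX : X ↣ ℕ) →
    let open Expressions C X countC countX in
    (y : X) (β : Term) → β ∈ TermWithout y →
    let f = transfer⁺ y β in
    (S : Pred (Congruence ⁺) ℓ) → Satisfiable S →
    (⋀S : Congruence ⁺) → IsGLB _≼⁺_ S ⋀S → IsGLB _≼⁺_ (image f S) (f ⋀S)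
theorem6p4 C X countC countX y β _ S _ ⋀S glb = record
  -- This half is monotonicity; the adjunction enters only in the other.
  { lower    = λ { _ (s , s∈S , refl) → transfer⁺-mono y β (IsGLB.lower glb s s∈S) }
  ; greatest = λ n n≤fS →
      transfer⁺-greatest y β glb n λ s s∈S → n≤fS _ (s , s∈S , refl)
  }
  where open TransferProperties C X countC countX
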